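{- Let $p$ be a prime, let $n>0$ be an integer, let $a\in \mathbb{F}_p[X]$ be a non-constant polynomial of degree at most $n-1$, and let $f_1,f_2\in\mathbb{F}_p[X]$ be monic irreducible polynomials of degree $n$. Then there exists an even integer $k>0$ such that the $k$-chain $(a_0,a_1,\ldots,a_k)$ of $a$ with respect to $(f_1,f_2)$ is a cycle of length $k$, that is, $a_k=a_0=a$ and $a_0,a_1,\ldots,a_{k-1}$ are all distinct polynomials. Moreover, if $f_1\neq f_2$, then this cycle has even length $k\ge 4$.
   Context: $\mathbb{F}_p=\mathbb{Z}/p\mathbb{Z}$. $\mathcal{P}(p,n)$ denotes the set of all polynomials in $\mathbb{F}_p[X]$ of degree at most $n-1$ (including $0$). For a monic irreducible polynomial $f\in\mathbb{F}_p[X]$ of degree $n$ and a non-zero $a\in\mathcal{P}(p,n)$, $\mathrm{inv}_f(a)\in\mathcal{P}(p,n)$ denotes the multiplicative inverse of $a$ with respect to $f$: the unique polynomial of degree at most $n-1$ with $a\cdot \mathrm{inv}_f(a)\equiv 1 \pmod{f}$. For an integer $k>0$, a non-zero $a\in\mathcal{P}(p,n)$ and irreducible polynomials $f_1,f_2\in\mathbb{F}_p[X]$ of degree $n$, the $k$-chain of $a$ with respect to $(f_1,f_2)$ is the sequence $(a_0,a_1,\ldots,a_k)$ defined by $a_0=a$, $a_i=\mathrm{inv}_{f_1}(a_{i-1})$ if $i$ is odd, and $a_i=\mathrm{inv}_{f_2}(a_{i-1})$ if $i\geq 2$ is even. -}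

module Defs where

open import Algebra.Bundles using (RawRing)
import Algebra.Definitions.RawSemiring as RawSemiringDefinitions
open import Data.Fin using (Fin; zero; suc; toℕ; fromℕ; inject₁)
open import Data.Integer as ℤ using (ℤ)
import Data.Integer.Divisibility.Signed as ℤ
open import Data.List using (List; []; _∷_; map)
open import Data.Nat using (ℕ; zero; suc; _<_; _∸_)
open import Data.Nat.Divisibility using () renaming (_∣_ to _∣ℕ_; _∤_ to _∤ℕ_)
open import Data.Product using (_×_)
open import Data.Vec.Functional using (Vector)
open import Function using (_∘_)
open import Function.Definitions using (Injective)
open import Level using (_⊔_; 0ℓ)
open import Relation.Binary.PropositionalEquality using (_≡_)
open import Relation.Nullary using (¬_)

-- The quotient ℤ/pℤ as a setoid: integers, with congruence modulo p as equality.
ℤ/ : ℕ → RawRing 0ℓ 0ℓ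
ℤ/ p = record
  { Carrier = ℤ
  ; _≈_     = λ x y → ℤ.+ p ℤ.∣ x ℤ.- y
  ; _+_     = ℤ._+_
  ; _*_     = ℤ._*_
  ; -_      = ℤ.-_
  ; 0#      = ℤ.0ℤ
  ; 1#      = ℤ.1ℤ
  }

module Univariate {c ℓ} (R : RawRing c ℓ) where

  private module R = RawRing R

  -- Coefficient lists, constant term first. Trailing zeros are allowed, so the
  -- equality of polynomials is _≈ₚ_ and not the equality of lists.
  Poly : Set c
  Poly = List R.Carrier

  coeff : Poly → ℕ → R.Carrier
  coeff []      _       = R.0#
  coeff (x ∷ f) zero    = x
  coeff (x ∷ f) (suc i) = coeff f i

  infix 4 _≈ₚ_

  record _≈ₚ_ (f g : Poly) : Set ℓ where
    constructor mk≈
    field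
      coeff-≈ : ∀ i → coeff f i R.≈ coeff g i

  infixl 6 _+ₚ_
  infixl 7 _*ₚ_

  _+ₚ_ : Poly → Poly → Poly
  []      +ₚ g       = g
  (x ∷ f) +ₚ []      = x ∷ f
  (x ∷ f) +ₚ (y ∷ g) = (x R.+ y) ∷ (f +ₚ g)

  -- (x + X f) g = x g + X (f g)
  _*ₚ_ : Poly → Poly → Poly
  []      *ₚ g = []
  (x ∷ f) *ₚ g = map (x R.*_) g +ₚ (R.0# ∷ (f *ₚ g))

  polyRing : RawRing c ℓ
  polyRing = record
    { Carrier = Poly
    ; _≈_     = _≈ₚ_
    ; _+_     = _+ₚ_
    ; _*_     = _*ₚ_
    ; -_      = map R.-_
    ; 0#      = []
    ; 1#      = R.1# ∷ []
    }

  open RawRing polyRing public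
    using (_≈_; _≉_; _+_; _*_; -_; 0#; 1#; rawSemiring)
  open RawSemiringDefinitions rawSemiring public using (_∣_; Irreducible)

  -- The zero polynomial has degree at most d for every d.
  DegreeAtMost : ℕ → Poly → Set ℓ
  DegreeAtMost d f = ∀ i → d < i → coeff f i R.≈ R.0#

  NonConstant : Poly → Set ℓ
  NonConstant f = ¬ DegreeAtMost 0 f

  MonicOfDegree : ℕ → Poly → Set ℓ
  MonicOfDegree n f = DegreeAtMost n f × coeff f n R.≈ R.1#

  -- The set of polynomials of degree at most n - 1, used only for n > 0.
  𝒫 : ℕ → Poly → Set ℓ
  𝒫 n = DegreeAtMost (n ∸ 1)

  infix 4 _≡_[mod_]

  _≡_[mod_] : Poly → Poly → Poly → Set (c ⊔ ℓ)
  g ≡ h [mod f ] = f ∣ g + - h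

  -- b = inv_f(a), as a definite description: b is the one and only element of
  -- 𝒫 n with a b ≡ 1 modulo f, where n is the degree of f.
  record IsInverse (n : ℕ) (f a b : Poly) : Set (c ⊔ ℓ) where
    field
      reduced : 𝒫 n b
      inverse : a * b ≡ 1# [mod f ]
      unique  : ∀ b′ → 𝒫 n b′ → a * b′ ≡ 1# [mod f ] → b′ ≈ b

  -- s is the k-chain of a with respect to (f₁ , f₂). For i : Fin k, the index
  -- "suc i" runs over 1, …, k, and its predecessor is "inject₁ i".
  record IsChain (n : ℕ) (f₁ f₂ a : Poly) {k : ℕ} (s : Vector Poly (suc k)) : Set (c ⊔ ℓ) where
    field
      start : s zero ≈ a
      odd   : ∀ (i : Fin k) → 2 ∤ℕ toℕ (suc i) → IsInverse n f₁ (s (inject₁ i)) (s (suc i))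
      even  : ∀ (i : Fin k) → 2 ∣ℕ toℕ (suc i) → IsInverse n f₂ (s (inject₁ i)) (s (suc i))

  record IsCycle {k : ℕ} (s : Vector Poly (suc k)) : Set ℓ where
    field
      closed   : s (fromℕ k) ≈ s zero
      distinct : Injective _≡_ _≈_ (s ∘ inject₁)

{-# OPTIONS --safe #-}
module Submission where

-- Inversion modulo f₁ and inversion modulo f₂ are two involutions σ and τ of the finite set
-- of non-constant residues, and the chain of a is the sequence obtained by applying σ and τ
-- alternately.  Neither has a fixed point: if a² ≡ 1 modulo an irreducible f, then f divides
-- (a - 1)(a + 1), so that a is 1 or -1 and hence constant (self-inverse-constant).  The set of
-- non-constant residues is stable, because a b ≡ 1 with b constant is an equality of
-- polynomials and units are constant (inverse-constant).
--
-- The rest of the first claim concerns any two fixed-point-free involutions of a finite set.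
-- If x_i = x_j with j - i odd, then applying the involution of step i to both sides gives
-- x_{i+1} = x_{j-1}; repeating this ends in x_l = x_{l+1}, a fixed point (odd-gap).  If
-- x_i = x_j with j - i even, then the sequence can be run backwards to x_0 = x_{j-i} (rewind).
-- By the pigeonhole principle some repetition occurs, and the least even k > 0 with x_k = x_0
-- is the length of a cycle (cycle).
--
-- If k = 2, then b = inv_{f₁}(a) is also the inverse of a modulo f₂, so a b - 1 = q f₂ is
-- divisible by f₁, where deg q < n - 1 since deg (a b) is at most 2n - 2.  Either q = 0 and a
-- is a unit, hence constant, or q is invertible modulo f₁ and f₁ divides f₂, whence f₁ = f₂
-- as both are monic of degree n (common-inverse).
--
-- Inverses modulo f come from a Euclidean descent (zero-or-invertible): dividing f by g gives
-- f = q g + r, and an inverse of the remainder r ≡ - q g yields one of g.  When r = 0 the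
-- irreducibility of f decides: either g is a unit, or f divides g and g = 0.
--
-- Everything is done over a commutative ring with a decidable equality, inverses of non-zero
-- elements and an injection into a finite set; ℤ/pℤ is such a ring by Bézout.

open import Defs
open import Algebra.Bundles using (CommutativeRing)
import Algebra.Consequences.Setoid as Consequences
open import Algebra.Definitions.RawMagma using (_,_)
open import Algebra.Definitions.RawSemiring using (module Irreducible)
import Algebra.Properties.AbelianGroup as AbelianGroupProperties
import Algebra.Properties.CommutativeSemigroup as CommutativeSemigroupProperties
import Algebra.Properties.Ring as RingProperties
open import Data.Fin as Fin using (Fin; toℕ)
import Data.Fin.Properties as Fin
open import Data.Integer as ℤ using (ℤ)
import Data.Integer.Divisibility.Signed as ℤ
import Data.Integer.DivMod as ℤ
import Data.Integer.Properties as ℤ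
open import Data.List using ([]; _∷_; map)
open import Data.Nat as ℕ using (ℕ; zero; suc; _<_; _≤_; z≤n; s≤s)
open import Data.Nat.Coprimality using (Coprime; prime⇒coprime; coprime-Bézout)
import Data.Nat.Divisibility as ℕ
open import Data.Nat.Divisibility using () renaming (_∣_ to _∣ℕ_)
open import Data.Nat.GCD using (module Bézout)
open import Data.Nat.Primality using (Prime; prime⇒nonZero)
import Data.Nat.Properties as ℕ
open import Data.Product using (∃₂; ∃-syntax; _×_; _,_; proj₁; proj₂)
open import Data.Sum using (_⊎_; inj₁; inj₂; [_,_]′)
open import Function using (_∘_; id)
open import Level using (_⊔_; 0ℓ)
open import Relation.Binary.Bundles using (DecSetoid; Setoid)
open import Relation.Binary.Core using (Rel)
import Relation.Binary.Definitions as Binary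
open import Relation.Binary.Definitions using (tri<; tri≈; tri>)
open import Relation.Binary.PropositionalEquality as ≡ using (_≡_)
import Relation.Binary.Reasoning.Setoid as SetoidReasoning
open import Relation.Nullary using (¬_; Dec; yes; no; contradiction)
open import Relation.Nullary.Decidable using (map′; _×-dec_)
open import Relation.Unary using (Pred; Decidable)

-- Two fixed-point-free involutions applied alternately

-- The least number principle for decidable predicates.
least : ∀ {ℓ} {P : Pred ℕ ℓ} → Decidable P → ∀ n → P n → ∃[ m ] P m × (∀ {j} → j < m → ¬ P j)
least P? n Pn with P? 0
least P? n       Pn | yes P0 = 0 , P0 , λ ()
least P? zero    Pn | no ¬P0 = contradiction Pn ¬P0
least P? (suc n) Pn | no ¬P0 with m , Pm , below ← least (λ i → P? (suc i)) n Pn =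
  suc m , Pm , λ { {zero} _ → ¬P0 ; {suc j} (s≤s j<m) → below j<m }

-- A positive difference j - i is either odd, 2e + 1, or even and positive, 2(e + 1).
gap-parity : ∀ {i j} → i < j →
  ∃[ e ] j ≡ suc (e ℕ.* 2 ℕ.+ i) ⊎ ∃[ e ] j ≡ suc e ℕ.* 2 ℕ.+ i
gap-parity {i} {suc j} (s≤s i≤j) with i ℕ.≟ j
... | yes ≡.refl = inj₁ (0 , ≡.refl)
... | no i≢j with gap-parity (ℕ.≤∧≢⇒< i≤j i≢j)
...   | inj₁ (e , ≡.refl) = inj₂ (e , ≡.refl)
...   | inj₂ (e , ≡.refl) = inj₁ (suc e , ≡.refl)

module _ {c ℓ} (S : DecSetoid c ℓ) where
  open DecSetoid S using (Carrier; _≈_; _≟_; sym; trans)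

  -- An involution, up to the equality of S, without fixed points.
  record IsFreeInvolution (σ : Carrier → Carrier) : Set (c ⊔ ℓ) where
    field
      σ-cong     : ∀ {x y} → x ≈ y → σ x ≈ σ y
      involutive : ∀ x → σ (σ x) ≈ x
      free       : ∀ x → ¬ x ≈ σ x

  module Alternating {σ τ : Carrier → Carrier}
                     (σ-inv : IsFreeInvolution σ) (τ-inv : IsFreeInvolution τ)
                     (x₀ : Carrier) where

    -- The map applied at time i: σ if i is even and τ if i is odd, so that the i-th term of
    -- the orbit is produced by σ if i is odd.
    step : ℕ → Carrier → Carrier
    step 0             = σ
    step 1             = τ
    step (suc (suc i)) = step i

    orbit : ℕ → Carrier
    orbit zero    = x₀
    orbit (suc i) = step i (orbit i)

    private
      step-inv : ∀ i → IsFreeInvolution (step i)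
      step-inv 0             = σ-inv
      step-inv 1             = τ-inv
      step-inv (suc (suc i)) = step-inv i

      module Step i = IsFreeInvolution (step-inv i)

      step-periodic : ∀ e i → step (e ℕ.* 2 ℕ.+ i) ≡ step i
      step-periodic zero    i = ≡.refl
      step-periodic (suc e) i = step-periodic e i

      backward : ∀ e i {x} → step i (step (e ℕ.* 2 ℕ.+ i) x) ≈ x
      backward e i {x} rewrite step-periodic e i = Step.involutive i x

    -- Terms at odd distance differ: an equality moves inwards until two consecutive terms are
    -- equal, which is a fixed point.
    odd-gap : ∀ e i → ¬ orbit i ≈ orbit (suc (e ℕ.* 2 ℕ.+ i))
    odd-gap zero    i eq = Step.free i (orbit i) eq
    odd-gap (suc e) i eq = odd-gap e (suc i)
      (≡.subst (λ j → orbit (suc i) ≈ orbit (suc j)) (≡.sym (ℕ.+-suc (e ℕ.* 2) i))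
        (trans (Step.σ-cong i eq) (backward e i)))

    -- For i > 0 the terms at times i and i + 2e are produced by the same involution, so an
    -- equality between them can be transported back to time 0.
    rewind : ∀ e i → orbit i ≈ orbit (e ℕ.* 2 ℕ.+ i) → x₀ ≈ orbit (e ℕ.* 2 ℕ.+ 0)
    rewind e zero    eq = eq
    rewind e (suc i) eq = rewind e i
      (trans (sym (Step.involutive i (orbit i)))
        (trans
          (Step.σ-cong i (≡.subst (λ j → orbit (suc i) ≈ orbit j) (ℕ.+-suc (e ℕ.* 2) i) eq))
          (backward e i)))

    recurrence : ∀ {i j} → i < j → orbit i ≈ orbit j →
      ∃[ e ] suc e ℕ.* 2 ≤ j × orbit (suc e ℕ.* 2) ≈ x₀
    recurrence {i} i<j eq with gap-parity i<j
    ... | inj₁ (e , ≡.refl) = contradiction eq (odd-gap e i)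
    ... | inj₂ (e , ≡.refl) = e , ℕ.m≤m+n (suc e ℕ.* 2) i ,
      sym (≡.subst (λ j → x₀ ≈ orbit j) (ℕ.+-identityʳ (suc e ℕ.* 2)) (rewind (suc e) i eq))

    -- An alternating orbit in a finite set is a cycle of even length 2(e + 1).  Finiteness is
    -- given by an injection into a set with N elements.
    cycle : ∀ {N} (code : Carrier → Fin N) → (∀ {x y} → code x ≡ code y → x ≈ y) →
      ∃[ e ] orbit (suc e ℕ.* 2) ≈ x₀ ×
        (∀ {i j} → i < suc e ℕ.* 2 → j < suc e ℕ.* 2 → orbit i ≈ orbit j → i ≡ j)
    cycle {N} code code-inj
      with i , j , i<j , eq ← Fin.pigeonhole (ℕ.n<1+n N) (λ i → code (orbit (toℕ i)))
      with e₀ , _ , return₀ ← recurrence i<j (code-inj eq)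
      with e , return , minimal ← least (λ e → orbit (suc e ℕ.* 2) ≟ x₀) e₀ return₀
      = e , return , distinct
      where
      no-earlier : ∀ {i j} → i < j → j < suc e ℕ.* 2 → ¬ orbit i ≈ orbit j
      no-earlier i<j j<k eq with e′ , e′≤j , return′ ← recurrence i<j eq =
        minimal (ℕ.s<s⁻¹ (ℕ.*-cancelʳ-< 2 (suc e′) (suc e) (ℕ.≤-<-trans e′≤j j<k))) return′

      distinct : ∀ {i j} → i < suc e ℕ.* 2 → j < suc e ℕ.* 2 → orbit i ≈ orbit j → i ≡ j
      distinct {i} {j} i<k j<k eq with ℕ.<-cmp i j
      ... | tri< i<j _ _ = contradiction eq (no-earlier i<j j<k)
      ... | tri≈ _ i≡j _ = i≡j
      ... | tri> _ _ j<i = contradiction (sym eq) (no-earlier j<i i<k)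

-- Quotients of commutative rings

module _ {c ℓ} (R : CommutativeRing c ℓ) where
  open CommutativeRing R
  open RingProperties ring
  open AbelianGroupProperties +-abelianGroup using () renaming (⁻¹-anti-homo‿- to -[x-y]≈y-x)
  open CommutativeSemigroupProperties +-commutativeSemigroup using (interchange)
  open SetoidReasoning setoid

  record IsIdeal {ι} (I : Carrier → Set ι) : Set (c ⊔ ℓ ⊔ ι) where
    field
      resp     : ∀ {x y} → x ≈ y → I x → I y
      0-closed : I 0#
      +-closed : ∀ {x y} → I x → I y → I (x + y)
      *-closed : ∀ x {y} → I y → I (x * y)

  telescope : ∀ x y z → (x - y) + (y - z) ≈ x - z
  telescope x y z = begin
    (x - y) + (y - z)   ≈⟨ +-assoc x (- y) (y - z) ⟩
    x + (- y + (y - z)) ≈⟨ +-congˡ (+-assoc (- y) y (- z)) ⟨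
    x + ((- y + y) - z) ≈⟨ +-congˡ (+-congʳ (-‿inverseˡ y)) ⟩
    x + (0# - z)        ≈⟨ +-congˡ (+-identityˡ (- z)) ⟩
    x - z               ∎

  -- The quotient has the same elements and a coarser equality: x and y are identified when
  -- x - y lies in the ideal.  That relation may be presented by any _∼_ equivalent to it,
  -- in particular by a record type, from whose inhabitants x and y can be inferred.
  quotientRing : ∀ {ι} {I : Carrier → Set ι} → IsIdeal I →
    ∀ {_∼_ : Rel Carrier ι} → (∀ {x y} → I (x - y) → x ∼ y) → (∀ {x y} → x ∼ y → I (x - y)) →
    CommutativeRing c ι
  quotientRing {I = I} isIdeal {_∼_} wrap unwrap = record
    { Carrier = Carrier ; _≈_ = _∼_ ; _+_ = _+_ ; _*_ = _*_ ; -_ = -_ ; 0# = 0# ; 1# = 1#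
    ; isCommutativeRing = record
      { isRing = record
        { +-isAbelianGroup = record
          { isGroup = record
            { isMonoid = record
              { isSemigroup = record
                { isMagma = record
                  { isEquivalence = record
                    { refl  = lift refl
                    ; sym   = ∼-sym
                    ; trans = λ {x} {y} {z} p q →
                        wrap (resp (telescope x y z) (+-closed (unwrap p) (unwrap q)))
                    }
                  ; ∙-cong = λ {x} {y} {u} {v} p q →
                      wrap (resp (difference-of-sums x y u v) (+-closed (unwrap p) (unwrap q)))
                  }
                ; assoc = λ x y z → lift (+-assoc x y z)
                }
              ; identity = (λ x → lift (+-identityˡ x)) , (λ x → lift (+-identityʳ x))
              }
            ; inverse = (λ x → lift (-‿inverseˡ x)) , (λ x → lift (-‿inverseʳ x))
            ; ⁻¹-cong = λ {x} {y} p → wrap (resp (sym (-‿+-comm x (- y))) (neg-closed (unwrap p)))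
            }
          ; comm = λ x y → lift (+-comm x y)
          }
        ; *-cong = λ {x} {y} {u} {v} p q →
            wrap (resp (difference-of-products x y u v)
              (+-closed (*-closed u (unwrap p)) (*-closed y (unwrap q))))
        ; *-assoc    = λ x y z → lift (*-assoc x y z)
        ; *-identity = (λ x → lift (*-identityˡ x)) , (λ x → lift (*-identityʳ x))
        ; distrib    = (λ x y z → lift (distribˡ x y z)) , (λ x y z → lift (distribʳ x y z))
        }
      ; *-comm = λ x y → lift (*-comm x y)
      }
    }
    where
    open IsIdeal isIdeal

    neg-closed : ∀ {x} → I x → I (- x)
    neg-closed {x} p = resp (-1*x≈-x x) (*-closed (- 1#) p)

    lift : ∀ {x y} → x ≈ y → x ∼ y
    lift {x} {y} eq = wrap (resp (sym (x≈y⇒x∙y⁻¹≈ε eq)) 0-closed)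

    ∼-sym : ∀ {x y} → x ∼ y → y ∼ x
    ∼-sym {x} {y} p = wrap (resp (-[x-y]≈y-x x y) (neg-closed (unwrap p)))

    difference-of-sums : ∀ x y u v → (x - y) + (u - v) ≈ (x + u) - (y + v)
    difference-of-sums x y u v = begin
      (x - y) + (u - v)     ≈⟨ interchange x (- y) u (- v) ⟩
      (x + u) + (- y - v)   ≈⟨ +-congˡ (-‿+-comm y v) ⟩
      (x + u) - (y + v)     ∎

    difference-of-products : ∀ x y u v → u * (x - y) + y * (u - v) ≈ x * u - y * v
    difference-of-products x y u v = begin
      u * (x - y) + y * (u - v)             ≈⟨ +-cong (x[y-z]≈xy-xz u x y) (x[y-z]≈xy-xz y u v) ⟩
      (u * x - u * y) + (y * u - y * v)     ≈⟨ +-congʳ (+-cong (*-comm u x) (-‿cong (*-comm u y))) ⟩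
      (x * u - y * u) + (y * u - y * v)     ≈⟨ telescope (x * u) (y * u) (y * v) ⟩
      x * u - y * v                         ∎

-- The ring of polynomials

module PolynomialRing {c ℓ} (R : CommutativeRing c ℓ) where
  private module R where
    open CommutativeRing R public
    open RingProperties ring public
  open Univariate R.rawRing
  open _≈ₚ_

  infixr 8 _·_

  -- Multiplication of a polynomial by a scalar.
  _·_ : R.Carrier → Poly → Poly
  x · f = map (x R.*_) f

  coeff-+ : ∀ f g i → coeff (f + g) i R.≈ coeff f i R.+ coeff g i
  coeff-+ []      g       i       = R.sym (R.+-identityˡ _)
  coeff-+ (x ∷ f) []      i       = R.sym (R.+-identityʳ _)
  coeff-+ (x ∷ f) (y ∷ g) zero    = R.refl
  coeff-+ (x ∷ f) (y ∷ g) (suc i) = coeff-+ f g i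

  coeff-neg : ∀ f i → coeff (- f) i R.≈ R.- coeff f i
  coeff-neg []      i       = R.sym R.-0#≈0#
  coeff-neg (x ∷ f) zero    = R.refl
  coeff-neg (x ∷ f) (suc i) = coeff-neg f i

  coeff-· : ∀ x f i → coeff (x · f) i R.≈ x R.* coeff f i
  coeff-· x []      i       = R.sym (R.zeroʳ x)
  coeff-· x (y ∷ f) zero    = R.refl
  coeff-· x (y ∷ f) (suc i) = coeff-· x f i

  private
    viaCoeffs : ∀ {f g} (u v : ℕ → R.Carrier) →
      (∀ i → coeff f i R.≈ u i) → (∀ i → coeff g i R.≈ v i) → (∀ i → u i R.≈ v i) → f ≈ g
    viaCoeffs u v p q e = mk≈ λ i → R.trans (p i) (R.trans (e i) (R.sym (q i)))

    setoid : Setoid c ℓ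
    setoid = record
      { Carrier = Poly ; _≈_ = _≈_
      ; isEquivalence = record
        { refl  = mk≈ λ _ → R.refl
        ; sym   = λ p → mk≈ λ i → R.sym (coeff-≈ p i)
        ; trans = λ p q → mk≈ λ i → R.trans (coeff-≈ p i) (coeff-≈ q i)
        }
      }
    open Setoid setoid using (refl; sym; trans)

    +-cong : ∀ {f f′ g g′} → f ≈ f′ → g ≈ g′ → f + g ≈ f′ + g′
    +-cong {f} {f′} {g} {g′} p q = viaCoeffs _ _ (coeff-+ f g) (coeff-+ f′ g′)
      λ i → R.+-cong (coeff-≈ p i) (coeff-≈ q i)

    +-assoc : ∀ f g h → (f + g) + h ≈ f + (g + h)
    +-assoc f g h = viaCoeffs _ _
      (λ i → R.trans (coeff-+ (f + g) h i) (R.+-congʳ (coeff-+ f g i)))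
      (λ i → R.trans (coeff-+ f (g + h) i) (R.+-congˡ (coeff-+ g h i)))
      (λ i → R.+-assoc (coeff f i) (coeff g i) (coeff h i))

    +-comm : ∀ f g → f + g ≈ g + f
    +-comm f g = viaCoeffs _ _ (coeff-+ f g) (coeff-+ g f) λ i → R.+-comm (coeff f i) (coeff g i)

    +-identityʳ : ∀ f → f + 0# ≈ f
    +-identityʳ f = trans (+-comm f 0#) refl

    neg-cong : ∀ {f g} → f ≈ g → - f ≈ - g
    neg-cong {f} {g} p = viaCoeffs _ _ (coeff-neg f) (coeff-neg g) λ i → R.-‿cong (coeff-≈ p i)

    +-inverseʳ : ∀ f → f + - f ≈ 0#
    +-inverseʳ f = mk≈ λ i →
      R.trans (coeff-+ f (- f) i) (R.trans (R.+-congˡ (coeff-neg f i)) (R.-‿inverseʳ (coeff f i)))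

    ·-cong : ∀ {x y f g} → x R.≈ y → f ≈ g → x · f ≈ y · g
    ·-cong {x} {y} {f} {g} p q = viaCoeffs _ _ (coeff-· x f) (coeff-· y g) λ i → R.*-cong p (coeff-≈ q i)

    ·-distribˡ : ∀ x f g → x · (f + g) ≈ x · f + x · g
    ·-distribˡ x f g = viaCoeffs _ _
      (λ i → R.trans (coeff-· x (f + g) i) (R.*-congˡ (coeff-+ f g i)))
      (λ i → R.trans (coeff-+ (x · f) (x · g) i) (R.+-cong (coeff-· x f i) (coeff-· x g i)))
      (λ i → R.distribˡ x (coeff f i) (coeff g i))

    ·-assoc : ∀ x y f → (x R.* y) · f ≈ x · y · f
    ·-assoc x y f = viaCoeffs _ _ (coeff-· (x R.* y) f)
      (λ i → R.trans (coeff-· x (y · f) i) (R.*-congˡ (coeff-· y f i)))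
      (λ i → R.*-assoc x y (coeff f i))

    ·-identity : ∀ f → R.1# · f ≈ f
    ·-identity f = mk≈ λ i → R.trans (coeff-· R.1# f i) (R.*-identityˡ (coeff f i))

    ·-zero : ∀ f → R.0# · f ≈ 0#
    ·-zero f = mk≈ λ i → R.trans (coeff-· R.0# f i) (R.zeroˡ (coeff f i))

  ∷-cong : ∀ {x y f g} → x R.≈ y → f ≈ g → x ∷ f ≈ y ∷ g
  ∷-cong p q = mk≈ λ { zero → p ; (suc i) → coeff-≈ q i }

  0∷0≈0 : R.0# ∷ 0# ≈ 0#
  0∷0≈0 = mk≈ λ { zero → R.refl ; (suc i) → R.refl }

  private
    open SetoidReasoning setoid

    +-congˡ : ∀ {f g h} → g ≈ h → f + g ≈ f + h
    +-congˡ {f} = +-cong (refl {f})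

    +-congʳ : ∀ {f g h} → g ≈ h → g + f ≈ h + f
    +-congʳ {f} p = +-cong p (refl {f})

    shift-cong : ∀ {f g} → f ≈ g → R.0# ∷ f ≈ R.0# ∷ g
    shift-cong = ∷-cong R.refl

    *-congˡ : ∀ f {g h} → g ≈ h → f * g ≈ f * h
    *-congˡ []      p = refl
    *-congˡ (x ∷ f) p = +-cong (·-cong R.refl p) (shift-cong (*-congˡ f p))

    *-zeroʳ : ∀ f → f * 0# ≈ 0#
    *-zeroʳ []      = refl
    *-zeroʳ (x ∷ f) = trans (shift-cong (*-zeroʳ f)) 0∷0≈0

    -- f (y + X g) = y f + X (f g): the recursion that defines the product, on the other side.
    *-∷ : ∀ f y g → f * (y ∷ g) ≈ y · f + (R.0# ∷ f * g)
    *-∷ []      y g = sym 0∷0≈0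
    *-∷ (x ∷ f) y g = ∷-cong (R.+-congʳ (R.*-comm x y)) (begin
      x · g + f * (y ∷ g)               ≈⟨ +-congˡ (*-∷ f y g) ⟩
      x · g + (y · f + (R.0# ∷ f * g))  ≈⟨ +-assoc (x · g) (y · f) _ ⟨
      (x · g + y · f) + (R.0# ∷ f * g)  ≈⟨ +-congʳ (+-comm (x · g) (y · f)) ⟩
      (y · f + x · g) + (R.0# ∷ f * g)  ≈⟨ +-assoc (y · f) (x · g) _ ⟩
      y · f + (x · g + (R.0# ∷ f * g))  ∎)

    *-comm : ∀ f g → f * g ≈ g * f
    *-comm []      g = sym (*-zeroʳ g)
    *-comm (x ∷ f) g = trans (+-congˡ (shift-cong (*-comm f g))) (sym (*-∷ g x f))

    *-cong : ∀ {f f′ g g′} → f ≈ f′ → g ≈ g′ → f * g ≈ f′ * g′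
    *-cong {f} {f′} {g} {g′} p q = begin
      f * g   ≈⟨ *-congˡ f q ⟩
      f * g′  ≈⟨ *-comm f g′ ⟩
      g′ * f  ≈⟨ *-congˡ g′ p ⟩
      g′ * f′ ≈⟨ *-comm g′ f′ ⟩
      f′ * g′ ∎

    interchange : ∀ f g h k → (f + g) + (h + k) ≈ (f + h) + (g + k)
    interchange = Consequences.comm∧assoc⇒middleFour setoid +-cong +-comm +-assoc

    *-distribˡ : ∀ f g h → f * (g + h) ≈ f * g + f * h
    *-distribˡ []      g h = refl
    *-distribˡ (x ∷ f) g h = begin
      x · (g + h) + (R.0# ∷ f * (g + h))
        ≈⟨ +-cong (·-distribˡ x g h) (∷-cong (R.sym (R.+-identityˡ R.0#)) (*-distribˡ f g h)) ⟩
      (x · g + x · h) + ((R.0# ∷ f * g) + (R.0# ∷ f * h))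
        ≈⟨ interchange (x · g) (x · h) _ _ ⟩
      (x ∷ f) * g + (x ∷ f) * h ∎

    *-distribʳ : ∀ f g h → (g + h) * f ≈ g * f + h * f
    *-distribʳ = Consequences.comm∧distrˡ⇒distrʳ setoid +-cong *-comm *-distribˡ

    shift-* : ∀ f g → (R.0# ∷ f) * g ≈ R.0# ∷ f * g
    shift-* f g = +-congʳ (·-zero g)

    ·-* : ∀ x f g → (x · f) * g ≈ x · (f * g)
    ·-* x []      g = refl
    ·-* x (y ∷ f) g = begin
      (x R.* y) · g + (R.0# ∷ (x · f) * g)
        ≈⟨ +-cong (·-assoc x y g) (∷-cong (R.sym (R.zeroʳ x)) (·-* x f g)) ⟩
      x · y · g + x · (R.0# ∷ f * g)
        ≈⟨ ·-distribˡ x (y · g) (R.0# ∷ f * g) ⟨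
      x · ((y ∷ f) * g) ∎

    *-assoc : ∀ f g h → (f * g) * h ≈ f * (g * h)
    *-assoc []      g h = refl
    *-assoc (x ∷ f) g h = begin
      (x · g + (R.0# ∷ f * g)) * h           ≈⟨ *-distribʳ h (x · g) (R.0# ∷ f * g) ⟩
      (x · g) * h + (R.0# ∷ f * g) * h       ≈⟨ +-cong (·-* x g h) (shift-* (f * g) h) ⟩
      x · (g * h) + (R.0# ∷ (f * g) * h)     ≈⟨ +-congˡ (shift-cong (*-assoc f g h)) ⟩
      x · (g * h) + (R.0# ∷ f * (g * h))     ∎

    *-identityˡ : ∀ f → 1# * f ≈ f
    *-identityˡ f = begin
      R.1# · f + (R.0# ∷ 0#) ≈⟨ +-cong (·-identity f) 0∷0≈0 ⟩
      f + 0#                 ≈⟨ +-identityʳ f ⟩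
      f                      ∎

  polynomialRing : CommutativeRing c ℓ
  polynomialRing = record
    { Carrier = Poly ; _≈_ = _≈_ ; _+_ = _+_ ; _*_ = _*_ ; -_ = -_ ; 0# = 0# ; 1# = 1#
    ; isCommutativeRing = record
      { isRing = record
        { +-isAbelianGroup = record
          { isGroup = record
            { isMonoid = record
              { isSemigroup = record
                { isMagma = record { isEquivalence = Setoid.isEquivalence setoid ; ∙-cong = +-cong }
                ; assoc   = +-assoc
                }
              ; identity = (λ f → refl) , +-identityʳ
              }
            ; inverse = (λ f → trans (+-comm (- f) f) (+-inverseʳ f)) , +-inverseʳ
            ; ⁻¹-cong = neg-cong
            }
          ; comm = +-comm
          }
        ; *-cong     = *-cong
        ; *-assoc    = *-assoc
        ; *-identity = *-identityˡ , λ f → trans (*-comm f 1#) (*-identityˡ f)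
        ; distrib    = *-distribˡ , *-distribʳ
        }
      ; *-comm = *-comm
      }
    }

-- Degrees and division with remainder

module Degree {c ℓ} (R : CommutativeRing c ℓ) where
  private module R where
    open CommutativeRing R public
    open RingProperties ring public
  open Univariate R.rawRing
  open _≈ₚ_
  open PolynomialRing R
  private module P where
    open CommutativeRing polynomialRing public
    open RingProperties ring public

  -- The degree of f is less than d; for d = 0 this says that f is zero.
  record DegreeBelow (d : ℕ) (f : Poly) : Set ℓ where
    constructor mkBelow
    field
      vanishes : ∀ i → d ≤ i → coeff f i R.≈ R.0#
  open DegreeBelow

  -- f has degree d and its leading coefficient is a unit.
  record UnitLead (d : ℕ) (f : Poly) : Set (c ⊔ ℓ) where
    field
      below  : DegreeBelow (suc d) f
      inv    : R.Carrier
      isUnit : coeff f d R.* inv R.≈ R.1#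

  below-mono : ∀ {d e f} → d ≤ e → DegreeBelow d f → DegreeBelow e f
  below-mono d≤e p = mkBelow λ i e≤i → vanishes p i (ℕ.≤-trans d≤e e≤i)

  below-resp : ∀ {d f g} → f ≈ g → DegreeBelow d f → DegreeBelow d g
  below-resp f≈g p = mkBelow λ i d≤i → R.trans (R.sym (coeff-≈ f≈g i)) (vanishes p i d≤i)

  below-+ : ∀ {d f g} → DegreeBelow d f → DegreeBelow d g → DegreeBelow d (f + g)
  below-+ {f = f} {g} p q = mkBelow λ i d≤i →
    R.trans (coeff-+ f g i) (R.trans (R.+-cong (vanishes p i d≤i) (vanishes q i d≤i)) (R.+-identityˡ R.0#))

  below-neg : ∀ {d f} → DegreeBelow d f → DegreeBelow d (- f)
  below-neg {f = f} p = mkBelow λ i d≤i →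
    R.trans (coeff-neg f i) (R.trans (R.-‿cong (vanishes p i d≤i)) R.-0#≈0#)

  below-1 : DegreeBelow 1 1#
  below-1 = mkBelow λ { (suc i) _ → R.refl }

  0-below : ∀ {d} → DegreeBelow d 0#
  0-below = mkBelow λ _ _ → R.refl

  below-0 : ∀ {f} → DegreeBelow 0 f → f ≈ 0#
  below-0 p = mk≈ λ i → vanishes p i z≤n

  below-tail : ∀ {d x f} → DegreeBelow (suc d) (x ∷ f) → DegreeBelow d f
  below-tail p = mkBelow λ i d≤i → vanishes p (suc i) (s≤s d≤i)

  coeff-∷-* : ∀ x f g i → coeff ((x ∷ f) * g) (suc i) R.≈ x R.* coeff g (suc i) R.+ coeff (f * g) i
  coeff-∷-* x f g i = R.trans (coeff-+ (x · g) (R.0# ∷ f * g) (suc i)) (R.+-congʳ (coeff-· x g (suc i)))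

  -- If deg f is at most d and deg g < e, then deg (f g) < d + e.
  below-* : ∀ {d e f g} → DegreeBelow (suc d) f → DegreeBelow e g → DegreeBelow (d ℕ.+ e) (f * g)
  below-* {f = []} p q = 0-below
  below-* {zero}  {e} {x ∷ f} {g} p q = mkBelow λ i e≤i → begin
    coeff (x · g + (R.0# ∷ f * g)) i            ≈⟨ coeff-+ (x · g) (R.0# ∷ f * g) i ⟩
    coeff (x · g) i R.+ coeff (R.0# ∷ f * g) i  ≈⟨ R.+-cong (coeff-· x g i) (coeff-≈ Xfg≈0 i) ⟩
    x R.* coeff g i R.+ R.0#                    ≈⟨ R.+-identityʳ _ ⟩
    x R.* coeff g i                             ≈⟨ R.*-congˡ (vanishes q i e≤i) ⟩
    x R.* R.0#                                  ≈⟨ R.zeroʳ x ⟩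
    R.0#                                        ∎
    where
    open SetoidReasoning R.setoid
    f≈0 : f ≈ 0#
    f≈0 = below-0 (below-tail p)
    Xfg≈0 : R.0# ∷ f * g ≈ 0#
    Xfg≈0 = P.trans (∷-cong R.refl (P.*-congʳ {g} {f} f≈0)) 0∷0≈0
  below-* {suc d} {e} {x ∷ f} {g} p q = mkBelow λ { (suc i) (s≤s d+e≤i) → begin
      coeff ((x ∷ f) * g) (suc i)                   ≈⟨ coeff-∷-* x f g i ⟩
      x R.* coeff g (suc i) R.+ coeff (f * g) i
        ≈⟨ R.+-cong (R.*-congˡ (g-vanishes d+e≤i)) (vanishes fg i d+e≤i) ⟩
      x R.* R.0# R.+ R.0#                           ≈⟨ R.+-identityʳ _ ⟩
      x R.* R.0#                                    ≈⟨ R.zeroʳ x ⟩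
      R.0#                                          ∎ }
    where
    open SetoidReasoning R.setoid
    g-vanishes : ∀ {i} → d ℕ.+ e ≤ i → coeff g (suc i) R.≈ R.0#
    g-vanishes {i} d+e≤i = vanishes q (suc i) (ℕ.≤-trans (ℕ.m≤n+m e d) (ℕ.m≤n⇒m≤1+n d+e≤i))
    fg : DegreeBelow (d ℕ.+ e) (f * g)
    fg = below-* {d} {e} {f} {g} (below-tail p) q

  -- Multiplication by a polynomial of degree n with unit leading coefficient raises the
  -- degree by exactly n: if deg (q f) < n + m, then deg q < m.
  cancel-degree : ∀ {n m f} → UnitLead n f → ∀ q → DegreeBelow (n ℕ.+ m) (q * f) → DegreeBelow m q
  cancel-degree lead []      p = 0-below
  cancel-degree {n} {m} {f} lead (x ∷ q) p = by-cases m p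
    where
    open UnitLead lead
    open SetoidReasoning R.setoid

    tail-product : ∀ i → n ≤ i → coeff ((x ∷ q) * f) (suc i) R.≈ R.0# → coeff (q * f) i R.≈ R.0#
    tail-product i n≤i eq = begin
      coeff (q * f) i                            ≈⟨ R.+-identityˡ _ ⟨
      R.0# R.+ coeff (q * f) i                   ≈⟨ R.+-congʳ x*f₁₊ᵢ≈0 ⟨
      x R.* coeff f (suc i) R.+ coeff (q * f) i  ≈⟨ coeff-∷-* x q f i ⟨
      coeff ((x ∷ q) * f) (suc i)                ≈⟨ eq ⟩
      R.0#                                       ∎
      where
      x*f₁₊ᵢ≈0 : x R.* coeff f (suc i) R.≈ R.0#
      x*f₁₊ᵢ≈0 = R.trans (R.*-congˡ (vanishes below (suc i) (s≤s n≤i))) (R.zeroʳ x)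

    -- By tail-product, deg (q f) < n + (m - 1), with m - 1 read as 0 if m = 0, so the induction
    -- hypothesis bounds q.  For m = 0 it gives q = 0, and the coefficient of X^n in
    -- (x + X q) f = x f is x times the leading coefficient of f.
    by-cases : ∀ m → DegreeBelow (n ℕ.+ m) ((x ∷ q) * f) → DegreeBelow m (x ∷ q)
    by-cases (suc m) p = mkBelow λ { (suc i) (s≤s m≤i) → vanishes q<m i m≤i }
      where
      q<m : DegreeBelow m q
      q<m = cancel-degree {n} {m} lead q (mkBelow λ j n+m≤j →
        tail-product j (ℕ.≤-trans (ℕ.m≤m+n n m) n+m≤j)
          (vanishes p (suc j) (ℕ.≤-trans (ℕ.≤-reflexive (ℕ.+-suc n m)) (s≤s n+m≤j))))
    by-cases zero p = mkBelow λ { zero _ → x≈0 ; (suc i) _ → vanishes q<0 i z≤n }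
      where
      q<0 : DegreeBelow 0 q
      q<0 = cancel-degree {n} {0} lead q (mkBelow λ j n+0≤j →
        tail-product j (ℕ.≤-trans (ℕ.m≤m+n n 0) n+0≤j) (vanishes p (suc j) (ℕ.m≤n⇒m≤1+n n+0≤j)))
      Xqf≈0 : R.0# ∷ q * f ≈ 0#
      Xqf≈0 = P.trans (∷-cong R.refl (P.*-congʳ {f} {q} (below-0 q<0))) 0∷0≈0
      x≈0 : x R.≈ R.0#
      x≈0 = begin
        x
          ≈⟨ R.*-identityʳ x ⟨
        x R.* R.1#
          ≈⟨ R.*-congˡ isUnit ⟨
        x R.* (coeff f n R.* inv)
          ≈⟨ R.*-assoc x (coeff f n) inv ⟨
        x R.* coeff f n R.* inv
          ≈⟨ R.*-congʳ (R.+-identityʳ _) ⟨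
        (x R.* coeff f n R.+ R.0#) R.* inv
          ≈⟨ R.*-congʳ (R.+-cong (coeff-· x f n) (coeff-≈ Xqf≈0 n)) ⟨
        (coeff (x · f) n R.+ coeff (R.0# ∷ q * f) n) R.* inv
          ≈⟨ R.*-congʳ (coeff-+ (x · f) (R.0# ∷ q * f) n) ⟨
        coeff ((x ∷ q) * f) n R.* inv
          ≈⟨ R.*-congʳ (vanishes p n (ℕ.≤-reflexive (ℕ.+-identityʳ n))) ⟩
        R.0# R.* inv
          ≈⟨ R.zeroˡ inv ⟩
        R.0# ∎

  -- Division with remainder.  For x + X g with g = q f + r, the remainder x + X r has degree
  -- at most d, and subtracting the multiple k f of f removes its coefficient of X^d.
  divide : ∀ {d f} → UnitLead d f → ∀ g → ∃₂ λ q r → g ≈ q * f + r × DegreeBelow d r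
  divide lead [] = [] , [] , P.refl , 0-below
  divide {d} {f} lead (x ∷ g) with q , r , g≈qf+r , r<d ← divide lead g =
    k ∷ q , (x ∷ r) + - (k · f) , eq , deg
    where
    open UnitLead lead
    k : R.Carrier
    k = coeff (x ∷ r) d R.* inv

    eq : x ∷ g ≈ (k ∷ q) * f + ((x ∷ r) + - (k · f))
    eq = begin
      x ∷ g
        ≈⟨ ∷-cong (R.sym (R.+-identityˡ x)) g≈qf+r ⟩
      Xqf + (x ∷ r)
        ≈⟨ P.+-congˡ {Xqf} (P.xyx⁻¹≈y (k · f) (x ∷ r)) ⟨
      Xqf + (k · f + (x ∷ r) + - (k · f))
        ≈⟨ P.+-congˡ {Xqf} (P.+-assoc (k · f) (x ∷ r) (- (k · f))) ⟩
      Xqf + (k · f + ((x ∷ r) + - (k · f)))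
        ≈⟨ P.+-assoc Xqf (k · f) ((x ∷ r) + - (k · f)) ⟨
      Xqf + k · f + ((x ∷ r) + - (k · f))
        ≈⟨ P.+-congʳ {(x ∷ r) + - (k · f)} (P.+-comm Xqf (k · f)) ⟩
      (k ∷ q) * f + ((x ∷ r) + - (k · f)) ∎
      where
      open SetoidReasoning P.setoid
      Xqf : Poly
      Xqf = R.0# ∷ q * f

    open SetoidReasoning R.setoid

    coeff-rem : ∀ i → coeff ((x ∷ r) + - (k · f)) i R.≈ coeff (x ∷ r) i R.- k R.* coeff f i
    coeff-rem i = begin
      coeff ((x ∷ r) + - (k · f)) i               ≈⟨ coeff-+ (x ∷ r) (- (k · f)) i ⟩
      coeff (x ∷ r) i R.+ coeff (- (k · f)) i     ≈⟨ R.+-congˡ (coeff-neg (k · f) i) ⟩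
      coeff (x ∷ r) i R.- coeff (k · f) i         ≈⟨ R.+-congˡ (R.-‿cong (coeff-· k f i)) ⟩
      coeff (x ∷ r) i R.- k R.* coeff f i         ∎

    k-lead : k R.* coeff f d R.≈ coeff (x ∷ r) d
    k-lead = begin
      coeff (x ∷ r) d R.* inv R.* coeff f d    ≈⟨ R.*-assoc _ inv (coeff f d) ⟩
      coeff (x ∷ r) d R.* (inv R.* coeff f d)  ≈⟨ R.*-congˡ (R.trans (R.*-comm inv (coeff f d)) isUnit) ⟩
      coeff (x ∷ r) d R.* R.1#                 ≈⟨ R.*-identityʳ _ ⟩
      coeff (x ∷ r) d                          ∎

    deg : DegreeBelow d ((x ∷ r) + - (k · f))
    deg = mkBelow deg-at
      where
      deg-at : ∀ i → d ≤ i → coeff ((x ∷ r) + - (k · f)) i R.≈ R.0#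
      deg-at i d≤i with ℕ.m≤n⇒m<n∨m≡n d≤i
      ... | inj₂ ≡.refl = R.trans (coeff-rem d) (R.x≈y⇒x∙y⁻¹≈ε (R.sym k-lead))
      ... | inj₁ (s≤s {n = j} d≤j) = begin
        coeff ((x ∷ r) + - (k · f)) (suc j)       ≈⟨ coeff-rem (suc j) ⟩
        coeff r j R.- k R.* coeff f (suc j)
          ≈⟨ R.+-cong (vanishes r<d j d≤j) (R.-‿cong (R.*-congˡ (vanishes below (suc j) (s≤s d≤j)))) ⟩
        R.0# R.- k R.* R.0#                       ≈⟨ R.x≈y⇒x∙y⁻¹≈ε (R.sym (R.zeroʳ k)) ⟩
        R.0#                                      ∎

-- Inversion modulo an irreducible polynomial over a finite field

-- A field with decidable equality and an injection into a finite set.  The injection need not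
-- respect _≈_: different representatives of an element may have different codes.  That 1 and 0
-- differ is not required.
record IsFiniteField {c ℓ} (R : CommutativeRing c ℓ) : Set (c ⊔ ℓ) where
  open CommutativeRing R
  field
    _≟_      : Binary.Decidable _≈_
    inverses : ∀ x → ¬ x ≈ 0# → ∃[ y ] x * y ≈ 1#
    size     : ℕ
    code     : Carrier → Fin size
    code-inj : ∀ {x y} → code x ≡ code y → x ≈ y

funToFin-injective : ∀ {m n} (f g : Fin m → Fin n) →
  Fin.funToFin f ≡ Fin.funToFin g → ∀ i → f i ≡ g i
funToFin-injective {m} {n} f g eq i = ≡.trans (≡.sym (Fin.finToFun-funToFin f i))
  (≡.trans (≡.cong (λ u → Fin.finToFun {n} {m} u i) eq) (Fin.finToFun-funToFin g i))

module FiniteField {c ℓ} (R : CommutativeRing c ℓ) (isFiniteField : IsFiniteField R) where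
  private module R where
    open CommutativeRing R public
    open RingProperties ring public
  open IsFiniteField isFiniteField
  open Univariate R.rawRing
  open _≈ₚ_
  open PolynomialRing R
  open Degree R
  open DegreeBelow
  private module P where
    open CommutativeRing polynomialRing public
    open RingProperties ring public

  -- A polynomial of degree at most e has smaller degree, or a unit as coefficient of X^e.
  lower-or-lead : ∀ {e g} → DegreeBelow (suc e) g → DegreeBelow e g ⊎ UnitLead e g
  lower-or-lead {e} {g} g≤e with coeff g e ≟ R.0#
  ... | no  gₑ≉0 with u , eq ← inverses (coeff g e) gₑ≉0 =
    inj₂ (record { below = g≤e ; inv = u ; isUnit = eq })
  ... | yes gₑ≈0 = inj₁ (mkBelow λ i e≤i →
    [ vanishes g≤e i , (λ { ≡.refl → gₑ≈0 }) ]′ (ℕ.m≤n⇒m<n∨m≡n e≤i))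

  zero-or-lead : ∀ e {g} → DegreeBelow e g → g ≈ 0# ⊎ ∃[ d ] UnitLead d g
  zero-or-lead zero    g<0 = inj₁ (below-0 g<0)
  zero-or-lead (suc e) g≤e with lower-or-lead g≤e
  ... | inj₁ g<e  = zero-or-lead e g<e
  ... | inj₂ lead = inj₂ (e , lead)

  -- Units are constant.  If b = 0, then 1 = 0 and every polynomial is zero.
  unit-constant : ∀ {e} a {b} → DegreeBelow e b → a * b ≈ 1# → DegreeBelow 1 a
  unit-constant {e} a {b} b<e ab≈1 with zero-or-lead e b<e
  ... | inj₂ (d , lead) = cancel-degree lead a
    (below-resp (P.sym ab≈1) (below-mono (ℕ.m≤n+m 1 d) below-1))
  ... | inj₁ b≈0 = below-resp (P.sym a≈0) 0-below
    where
    a≈0 : a ≈ 0#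
    a≈0 = begin
      a             ≈⟨ P.*-identityʳ a ⟨
      a * 1#        ≈⟨ P.*-congˡ {a} ab≈1 ⟨
      a * (a * b)   ≈⟨ P.*-congˡ {a} (P.*-congˡ {a} b≈0) ⟩
      a * (a * 0#)  ≈⟨ P.*-congˡ {a} (P.zeroʳ a) ⟩
      a * 0#        ≈⟨ P.zeroʳ a ⟩
      0#            ∎
      where open SetoidReasoning P.setoid

  -- The non-constant polynomials of degree less than n; the inversions act on these.
  Residue : ℕ → Set (c ⊔ ℓ)
  Residue n = ∃[ a ] DegreeBelow n a × NonConstant a

  _≟ₚ0 : ∀ g → Dec (g ≈ 0#)
  []      ≟ₚ0 = yes P.refl
  (x ∷ g) ≟ₚ0 = map′
    (λ (x≈0 , g≈0) → P.trans (∷-cong x≈0 g≈0) 0∷0≈0)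
    (λ xg≈0 → coeff-≈ xg≈0 0 , mk≈ λ i → coeff-≈ xg≈0 (suc i))
    (x ≟ R.0# ×-dec g ≟ₚ0)

  residues : ℕ → DecSetoid (c ⊔ ℓ) ℓ
  residues n = record
    { Carrier = Residue n
    ; _≈_     = λ x y → proj₁ x ≈ proj₁ y
    ; isDecEquivalence = record
      { isEquivalence = record { refl = P.refl ; sym = P.sym ; trans = P.trans }
      ; _≟_ = λ (x , _) (y , _) → map′ (P.x∙y⁻¹≈ε⇒x≈y x y) P.x≈y⇒x∙y⁻¹≈ε ((x + - y) ≟ₚ0)
      }
    }

  -- The degree n of the modulus f is written m + 1; being positive, it makes 1 a reduced
  -- polynomial, and 𝒫 n is definitionally the condition of having degree below n.
  module Modulus (m : ℕ) (f : Poly) (monic : MonicOfDegree (suc m) f) (irreducible : Irreducible f) where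
    n : ℕ
    n = suc m

    lead : UnitLead n f
    lead = record
      { below = mkBelow (proj₁ monic) ; inv = R.1# ; isUnit = R.trans (R.*-identityʳ _) (proj₂ monic) }

    multiples : IsIdeal polynomialRing (f ∣_)
    multiples = record
      { resp     = λ { g≈h (q , qf≈g) → q , P.trans qf≈g g≈h }
      ; 0-closed = 0# , P.refl
      ; +-closed = λ { (q , qf≈g) (r , rf≈h) → q + r , P.trans (P.distribʳ f q r) (P.+-cong qf≈g rf≈h) }
      ; *-closed = λ { g (q , qf≈h) → g * q , P.trans (P.*-assoc g q f) (P.*-congˡ {g} qf≈h) }
      }

    infix 4 _∼_

    -- Congruence modulo f.
    record _∼_ (g h : Poly) : Set (c ⊔ ℓ) where
      constructor mk∼
      field
        congruence : g ≡ h [mod f ]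
    open _∼_

    private
      residueRing : CommutativeRing c (c ⊔ ℓ)
      residueRing = quotientRing polynomialRing multiples {_∼_} mk∼ congruence
      module K where
        open CommutativeRing residueRing public
        open RingProperties ring public
        open CommutativeSemigroupProperties *-commutativeSemigroup public using (x∙yz≈y∙xz)

    open SetoidReasoning K.setoid

    ≈⇒∼ : ∀ {g h} → g ≈ h → g ∼ h
    ≈⇒∼ g≈h = mk∼ (0# , P.sym (P.x≈y⇒x∙y⁻¹≈ε g≈h))

    multiple∼0 : ∀ q → q * f ∼ 0#
    multiple∼0 q = mk∼ (q , P.sym (P.+-identityʳ (q * f)))

    f∼0 : f ∼ 0#
    f∼0 = K.trans (≈⇒∼ (P.sym (P.*-identityˡ f))) (multiple∼0 1#)

    -- Each class modulo f contains at most one polynomial of degree less than n.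
    reduced-≈ : ∀ {g h} → DegreeBelow n g → DegreeBelow n h → g ∼ h → g ≈ h
    reduced-≈ {g} {h} g<n h<n (mk∼ (q , qf≈g-h)) =
      P.x∙y⁻¹≈ε⇒x≈y g h (P.trans (P.sym qf≈g-h) (P.*-congʳ {f} {q} q≈0))
      where
      qf<n : DegreeBelow (n ℕ.+ 0) (q * f)
      qf<n = below-resp (P.sym qf≈g-h) (below-mono (ℕ.m≤m+n n 0) (below-+ g<n (below-neg h<n)))
      q≈0 : q ≈ 0#
      q≈0 = below-0 (cancel-degree lead q qf<n)

    -- A polynomial of degree less than n is zero or invertible modulo f, by descent on a bound
    -- e for its degree.
    zero-or-invertible : ∀ e → e ≤ n → ∀ g → DegreeBelow e g → g ≈ 0# ⊎ ∃[ b ] g * b ∼ 1#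
    zero-or-invertible zero    _   g g<0 = inj₁ (below-0 g<0)
    zero-or-invertible (suc e) e<n g g≤e with lower-or-lead g≤e
    ... | inj₁ g<e = zero-or-invertible e (ℕ.<⇒≤ e<n) g g<e
    ... | inj₂ g-lead with q , r , f≈qg+r , r<e ← divide g-lead f
                      with zero-or-invertible e (ℕ.<⇒≤ e<n) r r<e
    -- Since r ≡ - q g, the inverse s of r gives the inverse - q s of g.
    ...   | inj₂ (s , rs∼1) = inj₂ (- (q * s) , (begin
      g * - (q * s)     ≈⟨ K.-‿distribʳ-* g (q * s) ⟨
      - (g * (q * s))   ≈⟨ K.-‿cong (K.x∙yz≈y∙xz g q s) ⟩
      - (q * (g * s))   ≈⟨ K.-‿cong (K.*-assoc q g s) ⟨
      - (q * g * s)     ≈⟨ K.-‿distribˡ-* (q * g) s ⟩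
      - (q * g) * s     ≈⟨ K.*-congʳ {s} r∼-qg ⟨
      r * s             ≈⟨ rs∼1 ⟩
      1#                ∎))
      where
      r∼-qg : r ∼ - (q * g)
      r∼-qg = K.+-inverseʳ-unique (q * g) r (begin
        q * g + r  ≈⟨ ≈⇒∼ f≈qg+r ⟨
        f          ≈⟨ f∼0 ⟩
        0#         ∎)
    ...   | inj₁ r≈0 = by-irreducibility (Irreducible.split-∣1 irreducible f≈qg)
      where
      f≈qg : f ≈ q * g
      f≈qg = P.trans f≈qg+r (P.trans (P.+-congˡ {q * g} r≈0) (P.+-identityʳ (q * g)))
      by-irreducibility : q ∣ 1# ⊎ g ∣ 1# → g ≈ 0# ⊎ ∃[ b ] g * b ∼ 1#
      by-irreducibility (inj₂ (v , vg≈1)) = inj₂ (v , ≈⇒∼ (P.trans (P.*-comm g v) vg≈1))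
      -- If v q = 1, then g = v f is a multiple of f, and g is reduced.
      by-irreducibility (inj₁ (v , vq≈1)) = inj₁ (reduced-≈ (below-mono e<n g≤e) 0-below (begin
        g            ≈⟨ ≈⇒∼ (P.*-identityˡ g) ⟨
        1# * g       ≈⟨ ≈⇒∼ (P.*-congʳ {g} vq≈1) ⟨
        v * q * g    ≈⟨ ≈⇒∼ (P.*-assoc v q g) ⟩
        v * (q * g)  ≈⟨ ≈⇒∼ (P.*-congˡ {v} f≈qg) ⟨
        v * f        ≈⟨ multiple∼0 v ⟩
        0#           ∎))

    cancel : ∀ a b c → a * b ∼ 1# → a * c ∼ 0# → c ∼ 0#
    cancel a b c ab∼1 ac∼0 = begin
      c            ≈⟨ K.*-identityˡ c ⟨
      1# * c       ≈⟨ K.*-congʳ {c} ab∼1 ⟨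
      a * b * c    ≈⟨ K.*-congʳ {c} (K.*-comm a b) ⟩
      b * a * c    ≈⟨ K.*-assoc b a c ⟩
      b * (a * c)  ≈⟨ K.*-congˡ {b} ac∼0 ⟩
      b * 0#       ≈⟨ K.zeroʳ b ⟩
      0#           ∎

    inverse-unique : ∀ a {b b′} → DegreeBelow n b → DegreeBelow n b′ →
      a * b ∼ 1# → a * b′ ∼ 1# → b′ ≈ b
    inverse-unique a {b} {b′} b<n b′<n ab∼1 ab′∼1 = reduced-≈ b′<n b<n (K.x∙y⁻¹≈ε⇒x≈y b′ b
      (cancel a b (b′ + - b) ab∼1 (begin
        a * (b′ + - b)      ≈⟨ K.x[y-z]≈xy-xz a b′ b ⟩
        a * b′ + - (a * b)  ≈⟨ K.x≈y⇒x∙y⁻¹≈ε (K.trans ab′∼1 (K.sym ab∼1)) ⟩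
        0#                  ∎)))

    reduced-inverse : ∀ {a} → DegreeBelow n a → ¬ a ≈ 0# → ∃[ b ] DegreeBelow n b × a * b ∼ 1#
    reduced-inverse {a} a<n a≉0 with zero-or-invertible n ℕ.≤-refl a a<n
    ... | inj₁ a≈0 = contradiction a≈0 a≉0
    ... | inj₂ (b , ab∼1) with q , r , b≈qf+r , r<n ← divide lead b = r , r<n , (begin
      a * r            ≈⟨ K.*-congˡ {a} (K.+-identityˡ r) ⟨
      a * (0# + r)     ≈⟨ K.*-congˡ {a} (K.+-congʳ {r} (multiple∼0 q)) ⟨
      a * (q * f + r)  ≈⟨ K.*-congˡ {a} (≈⇒∼ b≈qf+r) ⟨
      a * b            ≈⟨ ab∼1 ⟩
      1#               ∎)

    private
      1<n : DegreeBelow n 1#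
      1<n = below-mono (s≤s z≤n) below-1

    -- If b is constant, then a b is reduced and a b ≡ 1 is an equality, so a is a unit.
    inverse-constant : ∀ {a b} → DegreeBelow n a → DegreeBelow 1 b → a * b ∼ 1# → DegreeBelow 1 a
    inverse-constant {a} {b} a<n b<1 ab∼1 = unit-constant a b<1 (reduced-≈
      (below-resp (P.*-comm b a) (below-* {0} {n} {b} {a} b<1 a<n)) 1<n ab∼1)

    -- If a² ≡ 1, then (a - 1)(a + 1) ≡ 0, so a is 1 or -1.
    self-inverse-constant : ∀ {a} → DegreeBelow n a → a * a ∼ 1# → DegreeBelow 1 a
    self-inverse-constant {a} a<n aa∼1
      with zero-or-invertible n ℕ.≤-refl (a + - 1#) (below-+ a<n (below-neg 1<n))
    ... | inj₁ a-1≈0 = below-resp (P.sym (P.x∙y⁻¹≈ε⇒x≈y a 1# a-1≈0)) below-1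
    ... | inj₂ (s , inverse) = below-resp (P.sym (P.+-inverseˡ-unique a 1# a+1≈0)) (below-neg below-1)
      where
      a+1≈0 : a + 1# ≈ 0#
      a+1≈0 = reduced-≈ (below-+ a<n 1<n) 0-below (cancel (a + - 1#) s (a + 1#) inverse (begin
        (a + - 1#) * (a + 1#)               ≈⟨ K.distribʳ (a + 1#) a (- 1#) ⟩
        a * (a + 1#) + - 1# * (a + 1#)      ≈⟨ K.+-cong (K.distribˡ a a 1#) (K.-1*x≈-x (a + 1#)) ⟩
        a * a + a * 1# + - (a + 1#)         ≈⟨ K.+-congʳ { - (a + 1#)} (K.+-cong aa∼1 (K.*-identityʳ a)) ⟩
        1# + a + - (a + 1#)                 ≈⟨ K.+-congʳ { - (a + 1#)} (K.+-comm 1# a) ⟩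
        a + 1# + - (a + 1#)                 ≈⟨ K.-‿inverseʳ (a + 1#) ⟩
        0#                                  ∎))

    -- Abstract, since the Euclidean descent should not be unfolded when inverses are compared.
    abstract
      invert : (x : Residue n) → ∃[ b ] DegreeBelow n b × (proj₁ x * b ∼ 1#)
      invert (a , a<n , nc) = reduced-inverse a<n λ a≈0 → nc (vanishes (below-resp (P.sym a≈0) 0-below))

    -- The map inv_f on the non-constant residues.
    inv : Residue n → Residue n
    inv x@(a , a<n , nc) =
      proj₁ (invert x) , proj₁ (proj₂ (invert x)) ,
      λ b<1 → nc (vanishes (inverse-constant a<n (mkBelow b<1) (proj₂ (proj₂ (invert x)))))

    inv-inverse : ∀ x → proj₁ x * proj₁ (inv x) ∼ 1#
    inv-inverse x = proj₂ (proj₂ (invert x))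

    inv-reduced : ∀ x → DegreeBelow n (proj₁ (inv x))
    inv-reduced x = proj₁ (proj₂ (inv x))

    inverse-of-inverse : ∀ x {a} → proj₁ (inv x) ≈ a → a * proj₁ x ∼ 1#
    inverse-of-inverse x {a} eq = begin
      a * proj₁ x              ≈⟨ K.*-congʳ {proj₁ x} (≈⇒∼ eq) ⟨
      proj₁ (inv x) * proj₁ x  ≈⟨ K.*-comm (proj₁ (inv x)) (proj₁ x) ⟩
      proj₁ x * proj₁ (inv x)  ≈⟨ inv-inverse x ⟩
      1#                       ∎

    inv-isInverse : ∀ x → IsInverse n f (proj₁ x) (proj₁ (inv x))
    inv-isInverse x = record
      { reduced = vanishes (inv-reduced x)
      ; inverse = congruence (inv-inverse x)
      ; unique  = λ b b<n ab∼1 →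
          inverse-unique (proj₁ x) (inv-reduced x) (mkBelow b<n) (inv-inverse x) (mk∼ ab∼1)
      }

    inv-free : IsFreeInvolution (residues n) inv
    inv-free = record
      { σ-cong     = λ {x} {y} x≈y →
          P.sym (inverse-unique (proj₁ x) (inv-reduced x) (inv-reduced y) (inv-inverse x)
            (K.trans (K.*-congʳ {proj₁ (inv y)} (≈⇒∼ x≈y)) (inv-inverse y)))
      ; involutive = λ x →
          P.sym (inverse-unique (proj₁ (inv x)) (inv-reduced (inv x)) (proj₁ (proj₂ x))
            (inv-inverse (inv x)) (inverse-of-inverse x P.refl))
      ; free       = λ x@(a , a<n , nc) a≈inv →
          nc (vanishes (self-inverse-constant a<n
            (K.trans (K.*-congˡ {a} (≈⇒∼ a≈inv)) (inv-inverse x))))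
      }

    -- If the non-constant a has the same inverse b modulo f and modulo f′, then f′ = f: for
    -- a b - 1 = q f′ the polynomial q has degree less than n - 1 = m, so q = 0 or f divides f′.
    common-inverse : ∀ {a b f′} → DegreeBelow n a → NonConstant a → DegreeBelow n b →
      MonicOfDegree n f′ → a * b ∼ 1# → f′ ∣ a * b + - 1# → f′ ≈ f
    common-inverse {a} {b} {f′} a<n nc b<n (f′≤n , f′-monic) ab∼1 (q , qf′≈ab-1)
      with zero-or-invertible n ℕ.≤-refl q (below-mono (ℕ.n≤1+n m) q<m)
      where
      lead′ : UnitLead n f′
      lead′ = record { below = mkBelow f′≤n ; inv = R.1# ; isUnit = R.trans (R.*-identityʳ _) f′-monic }
      q<m : DegreeBelow m q
      q<m = cancel-degree {n} lead′ q (below-resp (P.sym qf′≈ab-1)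
        (below-+ (below-mono (ℕ.≤-reflexive (ℕ.+-suc m m)) (below-* {m} {n} {a} {b} a<n b<n))
                 (below-neg (below-mono (s≤s z≤n) below-1))))
    ... | inj₁ q≈0 = contradiction (vanishes (unit-constant a b<n ab≈1)) nc
      where
      ab≈1 : a * b ≈ 1#
      ab≈1 = P.x∙y⁻¹≈ε⇒x≈y (a * b) 1# (P.trans (P.sym qf′≈ab-1) (P.*-congʳ {f′} {q} q≈0))
    ... | inj₂ (s , qs∼1) = P.x∙y⁻¹≈ε⇒x≈y f′ f (reduced-≈ f′-f<n 0-below (begin
      f′ + - f     ≈⟨ K.+-cong f′∼0 (K.-‿cong f∼0) ⟩
      0# + - 0#    ≈⟨ K.-‿inverseʳ 0# ⟩
      0#           ∎))
      where
      f′∼0 : f′ ∼ 0#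
      f′∼0 = cancel q s f′ qs∼1 (begin
        q * f′       ≈⟨ ≈⇒∼ qf′≈ab-1 ⟩
        a * b + - 1# ≈⟨ K.x≈y⇒x∙y⁻¹≈ε {a * b} {1#} ab∼1 ⟩
        0#           ∎)
      f′-f<n : DegreeBelow n (f′ + - f)
      f′-f<n = mkBelow f′-f-vanishes
        where
        f′-f-vanishes : ∀ i → n ≤ i → coeff (f′ + - f) i R.≈ R.0#
        f′-f-vanishes i n≤i with ℕ.m≤n⇒m<n∨m≡n n≤i
        ... | inj₁ n<i    = vanishes
          (below-+ {f = f′} { - f} (mkBelow f′≤n) (below-neg {f = f} (mkBelow (proj₁ monic)))) i n<i
        ... | inj₂ ≡.refl = R.trans (coeff-+ f′ (- f) n) (R.trans (R.+-congˡ (coeff-neg f n))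
          (R.x≈y⇒x∙y⁻¹≈ε (R.trans f′-monic (R.sym (proj₂ monic)))))

  -- The theorem for two moduli of degree n = m + 1 over any finite field.
  module TwoModuli (m : ℕ) {a f₁ f₂ : Poly} (nc : NonConstant a) (a<n : DegreeBelow (suc m) a)
    (monic₁ : MonicOfDegree (suc m) f₁) (irr₁ : Irreducible f₁)
    (monic₂ : MonicOfDegree (suc m) f₂) (irr₂ : Irreducible f₂) where
    private
      n : ℕ
      n = suc m
      module M₁ = Modulus m f₁ monic₁ irr₁
      module M₂ = Modulus m f₂ monic₂ irr₂
    open Alternating (residues n) M₁.inv-free M₂.inv-free (a , a<n , nc)

    -- A residue is determined by the codes of its first n coefficients.
    residue-code : Residue n → Fin (size ℕ.^ n)
    residue-code x = Fin.funToFin {n} λ i → code (coeff (proj₁ x) (toℕ i))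

    residue-code-inj : ∀ x y → residue-code x ≡ residue-code y → proj₁ x ≈ proj₁ y
    residue-code-inj (x , x<n , _) (y , y<n , _) eq = mk≈ agree
      where
      agree : ∀ i → coeff x i R.≈ coeff y i
      agree i with i ℕ.<? n
      ... | no  i≮n = R.trans (vanishes x<n i (ℕ.≮⇒≥ i≮n)) (R.sym (vanishes y<n i (ℕ.≮⇒≥ i≮n)))
      ... | yes i<n = ≡.subst (λ j → coeff x j R.≈ coeff y j) (Fin.toℕ-fromℕ< i<n)
        (code-inj (funToFin-injective {n}
          (λ j → code (coeff x (toℕ j))) (λ j → code (coeff y (toℕ j))) eq (Fin.fromℕ< i<n)))

    odd-step : ∀ i x → 2 ℕ.∤ suc i → IsInverse n f₁ (proj₁ x) (proj₁ (step i x))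
    odd-step 0             x _     = M₁.inv-isInverse x
    odd-step 1             x 2∤2   = contradiction ℕ.∣-refl 2∤2
    odd-step (suc (suc i)) x 2∤3+i = odd-step i x λ 2∣1+i → 2∤3+i (ℕ.∣m∣n⇒∣m+n ℕ.∣-refl 2∣1+i)

    even-step : ∀ i x → 2 ℕ.∣ suc i → IsInverse n f₂ (proj₁ x) (proj₁ (step i x))
    even-step 0             x 2∣1   = contradiction (ℕ.∣⇒≤ 2∣1) λ { (s≤s ()) }
    even-step 1             x _     = M₂.inv-isInverse x
    even-step (suc (suc i)) x 2∣3+i = even-step i x (ℕ.∣m+n∣m⇒∣n {m = 2} 2∣3+i ℕ.∣-refl)

    -- A cycle of length 2 would make the inverse of a modulo f₁ an inverse modulo f₂.
    long : ∀ e → proj₁ (orbit (suc e ℕ.* 2)) ≈ a → f₁ ≉ f₂ → 4 ≤ suc e ℕ.* 2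
    long (suc e) _ _ = s≤s (s≤s (s≤s (s≤s z≤n)))
    long zero return f₁≉f₂ = contradiction f₁≈f₂ f₁≉f₂
      where
      b : Residue n
      b = orbit 1
      ab∼1 : a * proj₁ b M₂.∼ 1#
      ab∼1 = M₂.inverse-of-inverse b return
      f₁≈f₂ : f₁ ≈ f₂
      f₁≈f₂ = M₂.common-inverse a<n nc (proj₁ (proj₂ b)) monic₁ ab∼1
        (M₁._∼_.congruence (M₁.inv-inverse (a , a<n , nc)))

    module _ {k : ℕ} where
      -- The chain (a_0, ..., a_k): the first k + 1 terms of the alternating orbit of a.
      chain : Fin (suc k) → Poly
      chain i = proj₁ (orbit (toℕ i))

      chain-inject₁ : ∀ (i : Fin k) → chain (Fin.inject₁ i) ≡ proj₁ (orbit (toℕ i))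
      chain-inject₁ i = ≡.cong (proj₁ ∘ orbit) (Fin.toℕ-inject₁ i)

      isChain : IsChain n f₁ f₂ a chain
      isChain = record
        { start = P.refl
        ; odd   = λ i 2∤1+i → ≡.subst (λ x → IsInverse n f₁ x (chain (Fin.suc i)))
                    (≡.sym (chain-inject₁ i)) (odd-step (toℕ i) (orbit (toℕ i)) 2∤1+i)
        ; even  = λ i 2∣1+i → ≡.subst (λ x → IsInverse n f₂ x (chain (Fin.suc i)))
                    (≡.sym (chain-inject₁ i)) (even-step (toℕ i) (orbit (toℕ i)) 2∣1+i)
        }

      isCycle : proj₁ (orbit k) ≈ a →
        (∀ {i j} → i < k → j < k → proj₁ (orbit i) ≈ proj₁ (orbit j) → i ≡ j) →
        IsCycle chain
      isCycle return distinct = record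
        { closed   = ≡.subst (λ i → proj₁ (orbit i) ≈ a) (≡.sym (Fin.toℕ-fromℕ k)) return
        ; distinct = λ {i} {j} eq → Fin.toℕ-injective (distinct (Fin.toℕ<n i) (Fin.toℕ<n j)
            (≡.subst₂ _≈_ (chain-inject₁ i) (chain-inject₁ j) eq))
        }

    chain-is-cycle : ∃[ k ] 0 < k × 2 ∣ℕ k ×
      (∃[ s ] IsChain n f₁ f₂ a {k} s × IsCycle s) × (f₁ ≉ f₂ → 4 ≤ k)
    chain-is-cycle =
      let e , return , distinct = cycle residue-code (λ {x} {y} → residue-code-inj x y) in
      suc e ℕ.* 2 , s≤s z≤n , ℕ.n∣m*n (suc e) ,
      (chain , isChain , isCycle return distinct) , long e return

-- The field of integers modulo a prime

module IntegersModulo (p : ℕ) where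
  open import Data.Integer using (+_; 0ℤ; 1ℤ)

  multiples : IsIdeal ℤ.+-*-commutativeRing (+ p ℤ.∣_)
  multiples = record
    { resp     = λ { ≡.refl p∣x → p∣x }
    ; 0-closed = ℤ.divides 0ℤ ≡.refl
    ; +-closed = ℤ.∣m∣n⇒∣m+n
    ; *-closed = ℤ.∣n⇒∣m*n
    }

  -- Its underlying raw ring is definitionally equal to ℤ/ p.
  ℤ/p : CommutativeRing 0ℓ 0ℓ
  ℤ/p = quotientRing ℤ.+-*-commutativeRing multiples {λ x y → + p ℤ.∣ x ℤ.- y} id id

  module _ (prime-p : Prime p) where
    private
      module F where
        open CommutativeRing ℤ/p public
        open RingProperties ring public
      instance _ = prime⇒nonZero prime-p

    ≈0-multiple : ∀ q → q ℤ.* + p F.≈ 0ℤ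
    ≈0-multiple q = ℤ.divides q (ℤ.+-identityʳ _)

    ≈remainder : ∀ x → x F.≈ + (x ℤ.%ℕ p)
    ≈remainder x = begin
      x                                          ≡⟨ ℤ.a≡a%ℕn+[a/ℕn]*n x p ⟩
      + (x ℤ.%ℕ p) ℤ.+ (x ℤ./ℕ p) ℤ.* + p
        ≈⟨ F.+-congˡ {+ (x ℤ.%ℕ p)} {(x ℤ./ℕ p) ℤ.* + p} {0ℤ} (≈0-multiple (x ℤ./ℕ p)) ⟩
      + (x ℤ.%ℕ p) ℤ.+ 0ℤ                        ≡⟨ ℤ.+-identityʳ (+ (x ℤ.%ℕ p)) ⟩
      + (x ℤ.%ℕ p)                               ∎
      where open SetoidReasoning F.setoid

    -- Bézout's identity 1 + x p = y r or 1 + y r = x p makes y or - y an inverse of r.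
    coprime-invertible : ∀ {r} → Coprime p r → ∃[ y ] + r ℤ.* y F.≈ 1ℤ
    coprime-invertible {r} coprime with coprime-Bézout coprime
    ... | Bézout.-+ x y 1+xp≡yr = + y , (begin
      + r ℤ.* + y               ≡⟨ ℤ.*-comm (+ r) (+ y) ⟩
      + y ℤ.* + r               ≡⟨ ℤ.pos-* y r ⟨
      + (y ℕ.* r)               ≡⟨ ≡.cong +_ 1+xp≡yr ⟨
      1ℤ ℤ.+ + (x ℕ.* p)        ≡⟨ ≡.cong (λ z → 1ℤ ℤ.+ z) (ℤ.pos-* x p) ⟩
      1ℤ ℤ.+ + x ℤ.* + p        ≈⟨ F.+-congˡ {1ℤ} {+ x ℤ.* + p} {0ℤ} (≈0-multiple (+ x)) ⟩
      1ℤ ℤ.+ 0ℤ                 ≡⟨⟩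
      1ℤ                        ∎)
      where open SetoidReasoning F.setoid
    ... | Bézout.+- x y 1+yr≡xp = ℤ.- + y , (begin
      + r ℤ.* ℤ.- + y           ≡⟨ ℤ.neg-distribʳ-* (+ r) (+ y) ⟨
      ℤ.- (+ r ℤ.* + y)         ≈⟨ F.+-inverseˡ-unique 1ℤ (+ r ℤ.* + y) 1+ry≈0 ⟨
      1ℤ                        ∎)
      where
      open SetoidReasoning F.setoid
      1+ry≈0 : 1ℤ ℤ.+ + r ℤ.* + y F.≈ 0ℤ
      1+ry≈0 = begin
        1ℤ ℤ.+ + r ℤ.* + y      ≡⟨ ≡.cong (λ z → 1ℤ ℤ.+ z) (ℤ.*-comm (+ r) (+ y)) ⟩
        1ℤ ℤ.+ + y ℤ.* + r      ≡⟨ ≡.cong (λ z → 1ℤ ℤ.+ z) (ℤ.pos-* y r) ⟨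
        + (1 ℕ.+ y ℕ.* r)       ≡⟨ ≡.cong +_ 1+yr≡xp ⟩
        + (x ℕ.* p)             ≡⟨ ℤ.pos-* x p ⟩
        + x ℤ.* + p             ≈⟨ ≈0-multiple (+ x) ⟩
        0ℤ                      ∎

    -- An integer is coded by its remainder modulo p.
    isFiniteField : IsFiniteField ℤ/p
    isFiniteField = record
      { _≟_      = λ x y → + p ℤ.∣? (x ℤ.- y)
      ; inverses = inverses
      ; size     = p
      ; code     = λ x → Fin.fromℕ< (ℤ.n%ℕd<d x p)
      ; code-inj = λ {x} {y} eq → begin
          x             ≈⟨ ≈remainder x ⟩
          + (x ℤ.%ℕ p)  ≡⟨ ≡.cong +_ (Fin.fromℕ<-injective _ _ _ _ eq) ⟩
          + (y ℤ.%ℕ p)  ≈⟨ ≈remainder y ⟨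
          y             ∎
      }
      where
      open SetoidReasoning F.setoid

      inverses : ∀ x → ¬ x F.≈ 0ℤ → ∃[ y ] x ℤ.* y F.≈ 1ℤ
      inverses x x≉0 with x ℤ.%ℕ p in x%p≡r | ≈remainder x
      ... | zero  | x≈0 = contradiction x≈0 x≉0
      ... | suc r | x≈1+r
        with y , inverse ← coprime-invertible
               (prime⇒coprime prime-p (≡.subst (_< p) x%p≡r (ℤ.n%ℕd<d x p)))
        = y , (begin
          x ℤ.* y          ≈⟨ F.*-congʳ {y} {x} {+ suc r} x≈1+r ⟩
          + suc r ℤ.* y    ≈⟨ inverse ⟩
          1ℤ               ∎)

theorem1 : (p : ℕ) → Prime p → (n : ℕ) → 0 < n →
    let open Univariate (ℤ/ p) in
    (a f₁ f₂ : Poly) →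
    NonConstant a → 𝒫 n a →
    MonicOfDegree n f₁ → Irreducible f₁ →
    MonicOfDegree n f₂ → Irreducible f₂ →
    ∃[ k ] 0 < k × 2 ∣ℕ k ×
    (∃[ s ] IsChain n f₁ f₂ a {k} s × IsCycle s) ×
    (f₁ ≉ f₂ → 4 ≤ k)
theorem1 p prime-p (suc m) _ a f₁ f₂ nc a<n monic₁ irr₁ monic₂ irr₂ =
  TwoModuli.chain-is-cycle m nc (Degree.mkBelow a<n) monic₁ irr₁ monic₂ irr₂
  where
  open IntegersModulo p
  open FiniteField ℤ/p (isFiniteField prime-p)
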